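{- Let $\mathcal{P}=(P,\leq)$ be a finite EL-shellable poset (in particular, $\mathcal{P}$ is bounded). For every integer $m>1$ we have $\mu_{\mathcal{P}^{[m]}}(\hat{\mathbf{0}},\hat{\mathbf{1}})=0$, where $\hat{\mathbf{0}}=(\hat 0,\ldots,\hat 0)$ and $\hat{\mathbf{1}}=(\hat 1,\ldots,\hat 1)$ are the least and the greatest element of the poset of $m$-multichains $\mathcal{P}^{[m]}$.
   Context: For a finite poset $\mathcal{P}=(P,\leq)$ and an integer $m>0$, let $P^{[m]}=\{(x_1,\ldots,x_m)\in P^m\mid x_1\leq x_2\leq\cdots\leq x_m\}$, and let $\mathcal{P}^{[m]}=(P^{[m]},\leq)$ with the componentwise order. A poset is bounded if it has a unique minimal element $\hat 0$ and a unique maximal element $\hat 1$. The Möbius function of a finite poset $\mathcal{Q}$ is defined by $\mu_{\mathcal{Q}}(x,x)=1$, $\mu_{\mathcal{Q}}(x,y)=-\sum_{x\leq z<y}\mu_{\mathcal{Q}}(x,z)$ if $x<y$, and $\mu_{\mathcal{Q}}(x,y)=0$ otherwise. Write $x\lessdot y$ if $x<y$ and there is no $z$ with $x<z<y$. An edge-labeling of a bounded poset $\mathcal{P}$ is a map $\lambda:\{(x,y)\mid x\lessdot y\}\to\Lambda$, where $(\Lambda,\leq_\Lambda)$ is an arbitrary poset. A maximal chain $x_1\lessdot\cdots\lessdot x_s$ of an interval $[x,y]=\{z\in P\mid x\leq z\leq y\}$ has label sequence $(\lambda(x_1,x_2),\ldots,\lambda(x_{s-1},x_s))$; it is rising if this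 sequence is strictly increasing. Tuples over $\Lambda$ are compared lexicographically: $(k_1,\ldots,k_s)\leq_{\mathrm{lex}}(l_1,\ldots,l_t)$ if and only if either $s\leq t$ and $k_i=l_i$ for all $i\leq s$, or $k_i<_\Lambda l_i$ for the least $i$ with $k_i\neq l_i$. The map $\lambda$ is an EL-labeling if for every interval $[x,y]$ there is a unique rising maximal chain in $[x,y]$, and its label sequence is $\leq_{\mathrm{lex}}$ the label sequence of every other maximal chain of $[x,y]$. A bounded poset is EL-shellable if it admits an EL-labeling.
   Formalization: The formal theorem adds the hypothesis that the least and greatest elements of P are distinct; for the one-element poset, which is vacuously EL-shellable, the Möbius value is 1, so the claim as stated fails there. -}

module Defs where

open import Data.Fin.Base using (Fin)
open import Data.Fin.Induction using (spo-wellFounded)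
open import Data.Integer.Base as ℤ using (ℤ; 0ℤ; 1ℤ; -_)
open import Data.Integer.Properties using (+-identityˡ)
open import Data.List.Base
  using (List; []; _∷_; map; foldr; filter; lookup; length; cartesianProductWith)
open import Data.List.Properties using (map-cong)
open import Data.List.Relation.Binary.Lex.NonStrict using (Lex-≤)
import Data.List.Relation.Binary.Pointwise as ListPW
open import Data.List.Relation.Unary.All using (All; []; _∷_)
open import Data.List.Relation.Unary.AllPairs using ([]; _∷_)
open import Data.List.Relation.Unary.Any using (here; there; index)
open import Data.List.Relation.Unary.Any.Properties using (lookup-index)
import Data.List.Relation.Unary.Linked as ListLinked
open import Data.List.Membership.Setoid.Properties using (∈-cartesianProductWith⁺)
import Data.List.Membership.Setoid as Membership
open import Data.List.Relation.Unary.Enumerates.Setoid using (IsEnumeration)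
open import Data.List.Relation.Unary.Unique.Setoid using (Unique)
import Data.List.Relation.Unary.Unique.Setoid.Properties as Unique
open import Data.Nat.Base using (ℕ; zero; suc)
open import Data.Product using (Σ; _×_; _,_; proj₁; proj₂; ∃!)
open import Data.Vec.Base using (Vec; []; _∷_; replicate)
import Data.Vec.Relation.Binary.Pointwise.Inductive as VecPW
open import Data.Vec.Relation.Binary.Pointwise.Inductive using ([]; _∷_)
open import Data.Vec.Relation.Unary.Linked using (Linked; []; [-]; _∷_; linked?)
open import Function.Base using (_on_; _∘_)
open import Induction.WellFounded as WF using (WellFounded)
open import Level using (Level; _⊔_) renaming (suc to lsuc)
open import Relation.Binary.Bundles using (Setoid; Poset; DecPoset)
open import Relation.Binary.Core using (Rel)
open import Relation.Binary.Definitions using (Decidable)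
open import Relation.Binary.PropositionalEquality.Core
  using (_≡_; refl; trans; cong)
import Relation.Binary.Construct.NonStrictToStrict as ToStrict
import Relation.Binary.Construct.On as On
import Relation.Binary.Properties.Poset as PosetProperties
open import Relation.Nullary using (¬_; Dec; yes; no; contradiction)
open import Relation.Nullary.Decidable using (_×-dec_)

private
  variable
    c ℓ₁ ℓ₂ a b d : Level
    A : Set a
    B : Set b

-- Equality is the equality _≈_ of the poset, and `elements` lists every
-- element exactly once up to _≈_.
record FinitePoset c ℓ₁ ℓ₂ : Set (lsuc (c ⊔ ℓ₁ ⊔ ℓ₂)) where
  field
    decPoset : DecPoset c ℓ₁ ℓ₂

  open DecPoset decPoset public
    renaming (refl to ≤-refl; reflexive to ≤-reflexive; trans to ≤-trans; antisym to ≤-antisym)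
  open PosetProperties poset public
    using (_<_; <-isStrictPartialOrder; <-irrefl; <-trans; <-respʳ-≈; <-respˡ-≈)

  field
    elements : List Carrier
    complete : IsEnumeration Eq.setoid elements
    unique   : Unique Eq.setoid elements

  infix 4 _<?_ _⋖_

  _<?_ : Decidable _<_
  _<?_ = ToStrict.<-decidable _≈_ _≤_ _≟_ _≤?_

  _⋖_ : Rel Carrier (c ⊔ ℓ₁ ⊔ ℓ₂)
  x ⋖ y = x < y × (∀ z → ¬ (x < z × z < y))

  Minimal : Carrier → Set (c ⊔ ℓ₁ ⊔ ℓ₂)
  Minimal x = ∀ y → ¬ (y < x)

  Maximal : Carrier → Set (c ⊔ ℓ₁ ⊔ ℓ₂)
  Maximal x = ∀ y → ¬ (x < y)

  <-wellFounded : WellFounded _<_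
  <-wellFounded =
    WF.Subrelation.wellFounded <⇒index< (On.wellFounded position index<-wellFounded)
    where
    at : Fin (length elements) → Carrier
    at = lookup elements

    position : Carrier → Fin (length elements)
    position x = index (complete x)

    index<-wellFounded : WellFounded (_<_ on at)
    index<-wellFounded =
      spo-wellFounded (On.isStrictPartialOrder at <-isStrictPartialOrder)

    <⇒index< : ∀ {x y} → x < y → at (position x) < at (position y)
    <⇒index< {x} {y} x<y =
      <-respʳ-≈ (lookup-index (complete y)) (<-respˡ-≈ (lookup-index (complete x)) x<y)

record Bounded (P : FinitePoset c ℓ₁ ℓ₂) : Set (c ⊔ ℓ₁ ⊔ ℓ₂) where
  open FinitePoset P
  field
    uniqueMinimal : ∃! _≈_ Minimal
    uniqueMaximal : ∃! _≈_ Maximal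

  0̂ : Carrier
  0̂ = proj₁ uniqueMinimal

  1̂ : Carrier
  1̂ = proj₁ uniqueMaximal

sum : List ℤ → ℤ
sum = foldr ℤ._+_ 0ℤ

private
  keep : Dec A → (A → ℤ) → ℤ
  keep (yes p) f = f p
  keep (no _)  f = 0ℤ

  keep-ext : {f g : A → ℤ} → (∀ p → f p ≡ g p) → ∀ A? → keep A? f ≡ keep A? g
  keep-ext eq (yes p) = eq p
  keep-ext eq (no _)  = refl

  sum-filter : {Q : A → Set b} (Q? : ∀ z → Dec (Q z)) (f : A → ℤ) (zs : List A) →
    sum (map (λ z → keep (Q? z) (λ _ → f z)) zs) ≡ sum (map f (filter Q? zs))
  sum-filter Q? f []       = refl
  sum-filter Q? f (z ∷ zs) with Q? z
  ... | yes _ = cong (λ s → f z ℤ.+ s) (sum-filter Q? f zs)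
  ... | no _  = trans (+-identityˡ _) (sum-filter Q? f zs)

  select : Dec A → Dec B → ℤ → ℤ
  select (yes _) _       s = 1ℤ
  select (no _)  (yes _) s = s
  select (no _)  (no _)  s = 0ℤ

  select-1 : ∀ (A? : Dec A) (B? : Dec B) {s} → A → select A? B? s ≡ 1ℤ
  select-1 (yes _) _ _ = refl
  select-1 (no ¬p) _ p = contradiction p ¬p

  select-s : ∀ (A? : Dec A) (B? : Dec B) {s} → ¬ A → B → select A? B? s ≡ s
  select-s (yes p) _       ¬p _ = contradiction p ¬p
  select-s (no _)  (yes _) _  _ = refl
  select-s (no _)  (no ¬q) _  q = contradiction q ¬q

  select-0 : ∀ (A? : Dec A) (B? : Dec B) {s} → ¬ A → ¬ B → select A? B? s ≡ 0ℤ
  select-0 (yes p) _       ¬p _  = contradiction p ¬p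
  select-0 (no _)  (yes q) _  ¬q = contradiction q ¬q
  select-0 (no _)  (no _)  _  _  = refl

module _ (Q : FinitePoset c ℓ₁ ℓ₂) where
  open FinitePoset Q

  private
    inside? : ∀ x y z → Dec (x ≤ z × z < y)
    inside? x y z = (x ≤? z) ×-dec (z <? y)

    step : ∀ x y → (∀ {z} → z < y → ℤ) → ℤ
    step x y rec = select (x ≟ y) (x <? y)
      (- sum (map (λ z → keep (inside? x y z) (λ (_ , z<y) → rec z<y)) elements))

  -- Well-founded recursion on the second argument; μ-≈, μ-< and μ-≰ below
  -- are the defining equations.
  μ : Carrier → Carrier → ℤ
  μ x = WF.All.wfRec <-wellFounded _ (λ _ → ℤ) (step x)

  private
    step-ext : ∀ x y {r r′ : ∀ {z} → z < y → ℤ} →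
               (∀ {z} (z<y : z < y) → r z<y ≡ r′ z<y) → step x y r ≡ step x y r′
    step-ext x y eq = cong (λ zs → select (x ≟ y) (x <? y) (- sum zs))
      (map-cong (λ z → keep-ext (λ (_ , z<y) → eq z<y) (inside? x y z)) elements)

    unfold : ∀ x y → μ x y ≡ step x y (λ {z} _ → μ x z)
    unfold x y =
      WF.FixPoint.unfold-wfRec <-wellFounded (λ _ → ℤ) (step x) (step-ext x)

  μ-≈ : ∀ {x y} → x ≈ y → μ x y ≡ 1ℤ
  μ-≈ {x} {y} x≈y = trans (unfold x y) (select-1 (x ≟ y) (x <? y) x≈y)

  μ-< : ∀ {x y} → x < y →
        μ x y ≡ - sum (map (μ x) (filter (λ z → (x ≤? z) ×-dec (z <? y)) elements))
  μ-< {x} {y} x<y = trans (unfold x y)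
    (trans (select-s (x ≟ y) (x <? y) (proj₂ x<y) x<y)
           (cong (λ s → - s) (sum-filter (inside? x y) (μ x) elements)))

  μ-≰ : ∀ {x y} → ¬ (x ≤ y) → μ x y ≡ 0ℤ
  μ-≰ {x} {y} x≰y = trans (unfold x y)
    (select-0 (x ≟ y) (x <? y) (x≰y ∘ ≤-reflexive) (x≰y ∘ proj₁))

module _ (P : FinitePoset c ℓ₁ ℓ₂) where
  open FinitePoset P

  Multichain : ℕ → Set (c ⊔ ℓ₂)
  Multichain m = Σ (Vec Carrier m) (Linked _≤_)

  constant : ∀ m → Carrier → Multichain m
  constant m x = replicate m x , linked m
    where
    linked : ∀ m → Linked _≤_ (replicate m x)
    linked zero          = []
    linked (suc zero)    = [-]
    linked (suc (suc m)) = ≤-refl ∷ linked (suc m)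

  private
    vecDecPoset : ℕ → DecPoset _ _ _
    vecDecPoset m = record
      { Carrier = Vec Carrier m
      ; _≈_     = VecPW.Pointwise _≈_
      ; _≤_     = VecPW.Pointwise _≤_
      ; isDecPartialOrder = record
        { isPartialOrder = record
          { isPreorder = record
            { isEquivalence = VecPW.isEquivalence isEquivalence m
            ; reflexive     = VecPW.map ≤-reflexive
            ; trans         = VecPW.trans ≤-trans
            }
          ; antisym = antisymmetric
          }
        ; _≟_  = VecPW.decidable _≟_
        ; _≤?_ = VecPW.decidable _≤?_
        }
      }
      where
      antisymmetric : ∀ {n} {xs ys : Vec Carrier n} →
        VecPW.Pointwise _≤_ xs ys → VecPW.Pointwise _≤_ ys xs → VecPW.Pointwise _≈_ xs ys
      antisymmetric []       []       = []
      antisymmetric (p ∷ ps) (q ∷ qs) = ≤-antisym p q ∷ antisymmetric ps qs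

  multichainDecPoset : ℕ → DecPoset (c ⊔ ℓ₂) (c ⊔ ℓ₁) (c ⊔ ℓ₂)
  multichainDecPoset m = On.decPoset (vecDecPoset m) (proj₁ {B = Linked _≤_})

  private
    vecSetoid : ℕ → Setoid _ _
    vecSetoid m = VecPW.setoid Eq.setoid m

    allVecs : ∀ m → List (Vec Carrier m)
    allVecs zero    = [] ∷ []
    allVecs (suc m) = cartesianProductWith _∷_ elements (allVecs m)

    allVecs-complete : ∀ m → IsEnumeration (vecSetoid m) (allVecs m)
    allVecs-complete zero    []       = here []
    allVecs-complete (suc m) (x ∷ xs) =
      ∈-cartesianProductWith⁺ Eq.setoid (vecSetoid m) (vecSetoid (suc m)) _∷_
        (complete x) (allVecs-complete m xs)

    allVecs-unique : ∀ m → Unique (vecSetoid m) (allVecs m)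
    allVecs-unique zero    = [] ∷ []
    allVecs-unique (suc m) =
      Unique.cartesianProductWith⁺ Eq.setoid (vecSetoid m) (vecSetoid (suc m))
        _∷_ VecPW.uncons unique (allVecs-unique m)

    linked-resp : ∀ {m} {xs ys : Vec Carrier m} →
                  VecPW.Pointwise _≈_ xs ys → Linked _≤_ xs → Linked _≤_ ys
    linked-resp []            []       = []
    linked-resp (_ ∷ [])      [-]      = [-]
    linked-resp (p ∷ q ∷ ps)  (r ∷ rs) =
      ≤-respʳ-≈ q (≤-respˡ-≈ p r) ∷ linked-resp (q ∷ ps) rs

    module _ (m : ℕ) where
      open DecPoset (multichainDecPoset m) using () renaming (module Eq to MEq)
      module V = Membership (vecSetoid m)
      module M = Membership MEq.setoid

      prepend : ∀ {v} → Dec (Linked _≤_ v) → List (Multichain m) → List (Multichain m)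
      prepend {v} (yes l) us = (v , l) ∷ us
      prepend     (no _)  us = us

      multichainsIn : List (Vec Carrier m) → List (Multichain m)
      multichainsIn []       = []
      multichainsIn (v ∷ vs) = prepend (linked? _≤?_ v) (multichainsIn vs)

      prepend-here : ∀ {v us} (l? : Dec (Linked _≤_ v)) (u : Multichain m) →
                     VecPW.Pointwise _≈_ (proj₁ u) v → u M.∈ prepend l? us
      prepend-here (yes _) u       u≈v = here u≈v
      prepend-here (no ¬l) (_ , l) u≈v = contradiction (linked-resp u≈v l) ¬l

      prepend-there : ∀ {v us} (l? : Dec (Linked _≤_ v)) {u : Multichain m} →
                      u M.∈ us → u M.∈ prepend l? us
      prepend-there (yes _) u∈ = there u∈
      prepend-there (no _)  u∈ = u∈

      ∈-multichainsIn : ∀ {vs} (u : Multichain m) → proj₁ u V.∈ vs → u M.∈ multichainsIn vs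
      ∈-multichainsIn {v ∷ _} u (here u≈v) = prepend-here (linked? _≤?_ v) u u≈v
      ∈-multichainsIn {v ∷ _} u (there u∈) =
        prepend-there (linked? _≤?_ v) {u} (∈-multichainsIn u u∈)

      Apart : Vec Carrier m → Vec Carrier m → Set _
      Apart v w = ¬ VecPW.Pointwise _≈_ v w

      prepend-apart : ∀ {v w us} (l? : Dec (Linked _≤_ w)) → Apart v w →
                      All (Apart v ∘ proj₁) us → All (Apart v ∘ proj₁) (prepend l? us)
      prepend-apart (yes _) v#w v#us = v#w ∷ v#us
      prepend-apart (no _)  v#w v#us = v#us

      multichainsIn-apart : ∀ {v} vs → All (Apart v) vs →
                            All (Apart v ∘ proj₁) (multichainsIn vs)
      multichainsIn-apart []       []           = []
      multichainsIn-apart (w ∷ vs) (v#w ∷ v#vs) =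
        prepend-apart (linked? _≤?_ w) v#w (multichainsIn-apart vs v#vs)

      prepend-unique : ∀ {v us} (l? : Dec (Linked _≤_ v)) → All (Apart v ∘ proj₁) us →
                       Unique MEq.setoid us → Unique MEq.setoid (prepend l? us)
      prepend-unique (yes _) v#us us! = v#us ∷ us!
      prepend-unique (no _)  v#us us! = us!

      multichainsIn-unique : ∀ vs → Unique (vecSetoid m) vs →
                             Unique MEq.setoid (multichainsIn vs)
      multichainsIn-unique []       []           = []
      multichainsIn-unique (v ∷ vs) (v#vs ∷ vs!) =
        prepend-unique (linked? _≤?_ v) (multichainsIn-apart vs v#vs)
                       (multichainsIn-unique vs vs!)

  multichainPoset : ℕ → FinitePoset (c ⊔ ℓ₂) (c ⊔ ℓ₁) (c ⊔ ℓ₂)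
  multichainPoset m = record
    { decPoset = multichainDecPoset m
    ; elements = multichainsIn m (allVecs m)
    ; complete = λ u → ∈-multichainsIn m u (allVecs-complete m (proj₁ u))
    ; unique   = multichainsIn-unique m (allVecs m) (allVecs-unique m)
    }

infix 8 _^[_]

_^[_] : FinitePoset c ℓ₁ ℓ₂ → ℕ → FinitePoset (c ⊔ ℓ₂) (c ⊔ ℓ₁) (c ⊔ ℓ₂)
P ^[ m ] = multichainPoset P m

module _ (P : FinitePoset c ℓ₁ ℓ₂) where
  open FinitePoset P

  infixr 5 _∷_

  -- The maximal chains x₁ ⋖ ⋯ ⋖ xₛ of the interval [x,y], with x₁ = x and xₛ ≈ y.
  data MaximalChain : Carrier → Carrier → Set (c ⊔ ℓ₁ ⊔ ℓ₂) where
    [_] : ∀ {x y} → x ≈ y → MaximalChain x y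
    _∷_ : ∀ {x z y} → x ⋖ z → MaximalChain z y → MaximalChain x y

  vertices : ∀ {x y} → MaximalChain x y → List Carrier
  vertices {x} [ _ ]     = x ∷ []
  vertices {x} (_ ∷ xs)  = x ∷ vertices xs

  infix 4 _≋_

  _≋_ : ∀ {x y} → Rel (MaximalChain x y) (c ⊔ ℓ₁)
  C ≋ D = ListPW.Pointwise _≈_ (vertices C) (vertices D)

  -- label-cong makes the label a function of the pair (x , y), independent of
  -- the proof of x ⋖ y and of the representatives up to _≈_.
  record EdgeLabeling (Λ : Poset a b d) : Set (c ⊔ ℓ₁ ⊔ ℓ₂ ⊔ a ⊔ b) where
    private module Λ = Poset Λ
    field
      label      : ∀ {x y} → x ⋖ y → Λ.Carrier
      label-cong : ∀ {x x′ y y′} → x ≈ x′ → y ≈ y′ →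
                   (e : x ⋖ y) (e′ : x′ ⋖ y′) → label e Λ.≈ label e′

    labels : ∀ {x y} → MaximalChain x y → List Λ.Carrier
    labels [ _ ]    = []
    labels (e ∷ es) = label e ∷ labels es

    infix 4 _≤lex_

    _≤lex_ : Rel (List Λ.Carrier) (a ⊔ b ⊔ d)
    _≤lex_ = Lex-≤ Λ._≈_ Λ._≤_

    Rising : ∀ {x y} → MaximalChain x y → Set (a ⊔ b ⊔ d)
    Rising C = ListLinked.Linked (PosetProperties._<_ Λ) (labels C)

    IsEL : Set (c ⊔ ℓ₁ ⊔ ℓ₂ ⊔ a ⊔ b ⊔ d)
    IsEL = ∀ {x y} → x ≤ y →
      Σ (∃! (_≋_ {x} {y}) Rising) λ (C , _) →
        ∀ (D : MaximalChain x y) → ¬ (C ≋ D) → labels C ≤lex labels D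

record ELShellable a b d (P : FinitePoset c ℓ₁ ℓ₂) :
                   Set (c ⊔ ℓ₁ ⊔ ℓ₂ ⊔ lsuc (a ⊔ b ⊔ d)) where
  field
    bounded  : Bounded P
    Λ        : Poset a b d
    labeling : EdgeLabeling P Λ
    isEL     : EdgeLabeling.IsEL labeling

  open Bounded bounded public

-- The map g (x₁,x₂,…,xₘ) = (0̂,x₂,…,xₘ) on P^[m] is monotone and deflationary, and only 𝟎 is
-- sent to 𝟎, because x₁ ≤ x₂ (here m > 1 enters).  The sums of μ(𝟎,·) over [𝟎,y] and [𝟎,g y]
-- both vanish when y ≠ 𝟎, and points of the former outside the latter are not fixed by g; so by
-- induction μ(𝟎,y) = 0 whenever g y ≠ y.  Since 0̂ ≠ 1̂, this applies to y = 𝟏.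
module Submission where

open import Defs
open import Data.Integer.Base using (ℤ; 0ℤ; _+_; -_)
open import Data.Integer.Properties using (+-assoc; +-comm; +-identityˡ; +-inverseˡ)
open import Data.List.Base using ([]; _∷_; map; filter)
open import Data.List.Membership.Propositional using (_∈_; find)
open import Data.List.Relation.Unary.All as All using (All; []; _∷_)
open import Data.List.Relation.Unary.AllPairs using ([]; _∷_)
open import Data.List.Relation.Unary.Any as Any using (here; there; any?)
open import Data.List.Relation.Unary.Unique.Setoid using (Unique)
open import Data.Nat.Base using (ℕ; suc; _<_; s≤s; z≤n)
open import Data.Product using (_×_; _,_; proj₁; proj₂; map₂)
open import Data.Sum.Base using (_⊎_; inj₁; inj₂)
open import Data.Vec.Base using (Vec; []; _∷_; replicate)
open import Data.Vec.Relation.Binary.Pointwise.Inductive using (Pointwise; []; _∷_)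
open import Data.Vec.Relation.Unary.Linked using (_∷_)
open import Function.Base using (_∘_; case_of_)
open import Induction.WellFounded using (Acc; acc)
open import Level using (Level)
open import Relation.Binary.Bundles using (Setoid)
open import Relation.Binary.PropositionalEquality.Core
  using (_≡_; refl; sym; trans; cong; cong₂)
open import Relation.Binary.PropositionalEquality.Properties using (module ≡-Reasoning)
open import Relation.Nullary using (¬_; yes; no; contradiction)
open import Relation.Nullary.Decidable using (_×-dec_)
open import Relation.Unary using (Pred; Decidable)

private
  variable
    a p q c ℓ ℓ₁ ℓ₂ : Level

module _ {A : Set a} {S : Pred A p} {T : Pred A q}
         (S? : Decidable S) (T? : Decidable T) (f : A → ℤ) where

  AgreeAt : A → Set _
  AgreeAt z = (S z → T z ⊎ f z ≡ 0ℤ) × (T z → S z)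

  sum-filter-agree : ∀ {zs} → All AgreeAt zs →
    sum (map f (filter S? zs)) ≡ sum (map f (filter T? zs))
  sum-filter-agree [] = refl
  sum-filter-agree {z ∷ zs} ((S⇒T , T⇒S) ∷ agree) with S? z | T? z
  ... | yes _ | yes _ = cong (f z +_) (sum-filter-agree agree)
  ... | no ¬s | yes t = contradiction (T⇒S t) ¬s
  ... | no _  | no _  = sum-filter-agree agree
  ... | yes s | no ¬t with S⇒T s
  ...   | inj₁ t    = contradiction t ¬t
  ...   | inj₂ fz≡0 = trans (cong₂ _+_ fz≡0 (sum-filter-agree agree)) (+-identityˡ _)

module _ (X : Setoid c ℓ) where
  open Setoid X using (_≈_; Carrier) renaming (sym to ≈-sym)

  module _ {S : Pred Carrier p} {T : Pred Carrier q}
           (S? : Decidable S) (T? : Decidable T) (f : Carrier → ℤ) where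

    -- Uniqueness up to `_≈_` leaves `w` as the only entry of its class, so agreement at all other
    -- entries leaves exactly the term `f w`. Membership of `w` is propositional because `f` is not
    -- assumed to respect `_≈_`.
    sum-filter-insert : ∀ {w zs} → Unique X zs → w ∈ zs → S w → ¬ T w →
      (∀ z → ¬ (z ≈ w) → AgreeAt S? T? f z) →
      sum (map f (filter S? zs)) ≡ f w + sum (map f (filter T? zs))
    sum-filter-insert {w} {_ ∷ zs} (w#zs ∷ _) (here refl) Sw ¬Tw agree with S? w | T? w
    ... | no ¬s | _     = contradiction Sw ¬s
    ... | yes _ | yes t = contradiction t ¬Tw
    ... | yes _ | no _  = cong (f w +_) (sum-filter-agree S? T? f
                            (All.map (λ w≉z → agree _ (w≉z ∘ ≈-sym)) w#zs))
    sum-filter-insert {w} {z ∷ zs} (z#zs ∷ zs!) (there w∈zs) Sw ¬Tw agree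
      with agree z (All.lookup z#zs w∈zs) | sum-filter-insert zs! w∈zs Sw ¬Tw agree
    ... | S⇒T , T⇒S | ih with S? z | T? z
    ...   | no ¬s | yes t = contradiction (T⇒S t) ¬s
    ...   | no _  | no _  = ih
    ...   | yes _ | yes _ = begin
      f z + _             ≡⟨ cong (f z +_) ih ⟩
      f z + (f w + _)   ≡⟨ sym (+-assoc (f z) (f w) _) ⟩
      (f z + f w) + _   ≡⟨ cong (_+ _) (+-comm (f z) (f w)) ⟩
      (f w + f z) + _   ≡⟨ +-assoc (f w) (f z) _ ⟩
      f w + (f z + _)   ∎
      where open ≡-Reasoning
    ...   | yes s | no ¬t with S⇒T s
    ...     | inj₁ t    = contradiction t ¬t
    ...     | inj₂ fz≡0 = trans (cong₂ _+_ fz≡0 ih) (+-identityˡ _)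

module _ (Q : FinitePoset c ℓ₁ ℓ₂) where
  open FinitePoset Q renaming (_<_ to _≺_)

  -- Well-founded descent below `y` stops at a minimal element, which is `x` by uniqueness. This
  -- turns the `0̂` of `Bounded`, given only as the unique minimal element, into a least element.
  minimal⇒least : ∀ {x} → (∀ {y} → Minimal y → x ≈ y) → ∀ y → x ≤ y
  minimal⇒least {x} x-unique y = go y (<-wellFounded y)
    where
    go : ∀ y → Acc _≺_ y → x ≤ y
    go y (acc rec) with any? (_<? y) elements
    ... | yes ∃z≺y = let z , _ , z≺y = find ∃z≺y in
                     ≤-trans (go z (rec z≺y)) (proj₁ z≺y)
    -- The search covers listed elements only; `complete` extends its failure to every `z`.
    ... | no ∄z≺y  = ≤-reflexive (x-unique λ z z≺y →
                     ∄z≺y (Any.map (λ z≈e → <-respˡ-≈ z≈e z≺y) (complete z)))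

  module _ (g : Carrier → Carrier)
           (g-mono : ∀ {y z} → y ≤ z → g y ≤ g z)
           (g-deflationary : ∀ y → g y ≤ y)
           {x : Carrier} (x≤gx : x ≤ g x)
           (g-above : ∀ {y} → x ≺ y → x ≺ g y) where

    private
      below? : ∀ y → Decidable (λ z → x ≤ z × z ≺ y)
      below? y z = (x ≤? z) ×-dec (z <? y)

      -- The recursion for `μ` at `y` sums over [x,y). Terms outside [x,g y] vanish by the induction
      -- hypothesis, and those inside sum to 0 by the recursion at `g y`. As `g` is deflationary,
      -- `¬ (y ≤ g y)` says that `g` moves `y`.
      μ-nonfixed-step : ∀ {y} → (∀ {z} → z ≺ y → ¬ (z ≤ g z) → μ Q x z ≡ 0ℤ) →
                        ¬ (y ≤ g y) → x ≤ y → μ Q x y ≡ 0ℤ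
      μ-nonfixed-step {y} ih y≰gy x≤y with find (complete (g y))
      ... | w , w∈elements , gy≈w = trans (μ-< Q x≺y) (cong -_ sum≡0)
        where
        x≺y : x ≺ y
        -- If `x ≈ y`, then `y ≤ x ≤ g x ≤ g y`.
        x≺y = x≤y , λ x≈y →
          y≰gy (≤-trans (≤-reflexive (Eq.sym x≈y)) (≤-trans x≤gx (g-mono x≤y)))

        x≺w : x ≺ w
        -- Strictness matters: for `w ≈ x` the sum over [x,w] would be 1, not 0.
        x≺w = <-respʳ-≈ gy≈w (g-above x≺y)

        w≺y : w ≺ y
        w≺y = <-respˡ-≈ gy≈w
          (g-deflationary y , λ gy≈y → y≰gy (≤-reflexive (Eq.sym gy≈y)))

        agree : ∀ z → ¬ (z ≈ w) → AgreeAt (below? y) (below? w) (μ Q x) z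
        agree z z≉w = left , map₂ (λ z≺w → <-trans z≺w w≺y)
          where
          left : x ≤ z × z ≺ y → (x ≤ z × z ≺ w) ⊎ μ Q x z ≡ 0ℤ
          left (x≤z , z≺y) with z ≤? w
          ... | yes z≤w = inj₁ (x≤z , z≤w , z≉w)
          -- Such a `z` is moved by `g`, since otherwise `z ≤ g z ≤ g y ≈ w`.
          ... | no z≰w  = inj₂ (ih z≺y λ z≤gz →
            z≰w (≤-trans z≤gz (≤-trans (g-mono (proj₁ z≺y)) (≤-reflexive gy≈w))))

        open ≡-Reasoning

        sum≡0 : sum (map (μ Q x) (filter (below? y) elements)) ≡ 0ℤ
        sum≡0 = begin
          sum (map (μ Q x) (filter (below? y) elements))
            ≡⟨ sum-filter-insert Eq.setoid (below? y) (below? w) (μ Q x) unique w∈elements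
                 (proj₁ x≺w , w≺y) (<-irrefl Eq.refl ∘ proj₂) agree ⟩
          μ Q x w + sum (map (μ Q x) (filter (below? w) elements))
            ≡⟨ cong (_+ sum (map (μ Q x) (filter (below? w) elements))) (μ-< Q x≺w) ⟩
          - sum (map (μ Q x) (filter (below? w) elements))
            + sum (map (μ Q x) (filter (below? w) elements))
            ≡⟨ +-inverseˡ (sum (map (μ Q x) (filter (below? w) elements))) ⟩
          0ℤ ∎

    μ-nonfixed : ∀ y → ¬ (y ≤ g y) → μ Q x y ≡ 0ℤ
    μ-nonfixed y = go (<-wellFounded y)
      where
      go : ∀ {y} → Acc _≺_ y → ¬ (y ≤ g y) → μ Q x y ≡ 0ℤ
      go {y} (acc rec) y≰gy = case x ≤? y of λ where
        -- Settling this case here keeps the induction hypothesis free of the side condition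
        -- `x ≤ y`.
        (no x≰y)  → μ-≰ Q x≰y
        (yes x≤y) → μ-nonfixed-step (λ z≺y → go (rec z≺y)) y≰gy x≤y

module _ (P : FinitePoset c ℓ₁ ℓ₂) where
  open FinitePoset P

  module _ {⊥ : Carrier} (⊥-least : ∀ x → ⊥ ≤ x) where

    replicate-least : ∀ {n} (xs : Vec Carrier n) → Pointwise _≤_ (replicate n ⊥) xs
    replicate-least []       = []
    replicate-least (x ∷ xs) = ⊥-least x ∷ replicate-least xs

    lowerHead : ∀ {n} → Multichain P (suc (suc n)) → Multichain P (suc (suc n))
    lowerHead (_ ∷ y ∷ ys , _ ∷ l) = ⊥ ∷ y ∷ ys , ⊥-least y ∷ l

    μ-multichain≡0 : ∀ {t} → ¬ (⊥ ≈ t) → ∀ n → let m = suc (suc n) in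
      μ (P ^[ m ]) (constant P m ⊥) (constant P m t) ≡ 0ℤ
    μ-multichain≡0 {t} ⊥≉t n =
      μ-nonfixed Q lowerHead
        (λ {u} {v} → mono {u} {v}) deflationary {𝟎} (Q.≤-refl {𝟎}) (λ {u} → above {u})
        -- Comparing first entries, a constant chain at `t` not moved by `lowerHead` would force
        -- `t ≤ ⊥`.
        (constant P m t) λ { (t≤⊥ ∷ _) → ⊥≉t (≤-antisym (⊥-least t) t≤⊥) }
      where
      m : ℕ
      m = suc (suc n)

      Q : FinitePoset _ _ _
      Q = P ^[ m ]

      module Q = FinitePoset Q

      𝟎 : Multichain P m
      𝟎 = constant P m ⊥

      mono : ∀ {u v} → u Q.≤ v → lowerHead u Q.≤ lowerHead v
      mono {_ ∷ _ ∷ _ , _ ∷ _} {_ ∷ _ ∷ _ , _ ∷ _} (_ ∷ ps) = ≤-refl ∷ ps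

      deflationary : ∀ u → lowerHead u Q.≤ u
      -- The tail of reflexivity supplies the comparisons beyond the first entry.
      deflationary u@(x ∷ _ ∷ _ , _ ∷ _) with Q.≤-refl {u}
      ... | _ ∷ ps = ⊥-least x ∷ ps

      above : ∀ {u} → 𝟎 Q.< u → 𝟎 Q.< lowerHead u
      above {x ∷ y ∷ ys , x≤y ∷ _} (_ , 𝟎≉u) =
        replicate-least (⊥ ∷ y ∷ ys) , λ { (_ ∷ ⊥≈y ∷ eqs) →
          -- Here `⊥ ≤ x ≤ y ≈ ⊥` forces `x ≈ ⊥`, so the original chain would already be `𝟎`.
          𝟎≉u (≤-antisym (⊥-least x) (≤-trans x≤y (≤-reflexive (Eq.sym ⊥≈y))) ∷ ⊥≈y ∷ eqs) }

proposition3p5 :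
    ∀ {c ℓ₁ ℓ₂ a b d} (P : FinitePoset c ℓ₁ ℓ₂) (shellable : ELShellable a b d P) →
    let open FinitePoset P using (_≈_)
        open ELShellable shellable
    in ¬ (0̂ ≈ 1̂) →
       (m : ℕ) → 1 < m →
       μ (P ^[ m ]) (constant P m 0̂) (constant P m 1̂) ≡ 0ℤ
proposition3p5 P shellable 0≉1 (suc (suc n)) (s≤s (s≤s z≤n)) =
  μ-multichain≡0 P (minimal⇒least P (proj₂ (proj₂ uniqueMinimal))) 0≉1 n
  where open ELShellable shellable
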